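{- Let $(\Lambda,\to_{p})$ be a pure calculus and $(\Lambda^X,\to)$ a calculus with explicit substitutions with $\Lambda\subset\Lambda^X$. Let the reduction rules of the latter be split into two disjoint sets $R_1$ and $R_2$, where the reduction $\to_{R_1}$ is terminating. Let $T$ be a typing system for the pure calculus and $T'$ a typing system for the calculus with explicit substitutions, and assume that every pure term typable with respect to $T$ is strongly normalizing in the pure calculus. Suppose that there exist a function $\mathit{Ateb}:\Lambda^X\to\Lambda$ and a binary relation $\mathcal{R}$ on $\Lambda^X$ such that: (Preservation of typability) for every $t\in\Lambda^X$ typable with respect to $T'$, the pure term $\mathit{Ateb}(t)$ is typable with respect to $T$ in the pure calculus; (Initialisation) for every typed term $t\in\Lambda^X$ (with respect to $T'$), there exists a term $u$ with $u\,\mathcal{R}\,t$ such that $\mathit{Ateb}(t)\to^* u$; (Simulation $^*$) for every term $t\in\Lambda^X$, if $t\to_{R_1}t'$ then for every $u\,\mathcal{R}\,t$ there exists $u'$ such that $u\to^* u'$ and $u'\,\mathcal{R}\,t'$; (Simulation $^+$) for every term $t\in\Lambda^X$, if $t\to_{R_2}t'$ then for every $u\,\mathcal{R}\,t$ there exists $u'$ such that $u\to^+ u'$ and $u'\,\mathcal{R}\,t'$. Then PSN implies SN with respect to $T'$. That is, if every pure term that is strongly normalizing for $\to_p$ is strongly normalizing for $\to$, then every term of $\Lambda^X$ typable with respect to $T'$ is strongly normalizing for $\to$.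
   Context: A calculus is a set of terms with a reduction relation. A pure calculus $(\Lambda,\to_p)$ has no explicit substitutions. A calculus with explicit substitutions $(\Lambda^X,\to)$ has as terms a set $\Lambda^X$ containing the pure terms $\Lambda$, and $\to\;=\;\to_{R_1}\cup\to_{R_2}$. $\to^*$ means zero or more steps of $\to$, and $\to^+$ one or more steps. A typing system singles out a subset of typable (typed) terms. A term is strongly normalizing for a reduction relation if there is no infinite reduction sequence starting from it. PSN: every pure term strongly normalizing in the pure calculus is strongly normalizing in the calculus with explicit substitutions. SN (with respect to a typing system): every typable term is strongly normalizing in the calculus with explicit substitutions. -}

module Defs where

open import Data.Product.Base using (∃-syntax; _×_)
open import Function.Base using (flip)
open import Induction.InfiniteDescent using (InfiniteDescendingSequenceFrom)
open import Level using (Level; _⊔_)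
open import Relation.Binary.Core using (Rel)
open import Relation.Nullary.Negation.Core using (¬_)
open import Relation.Unary using (Pred; _∈_)

private
  variable
    a b ℓ ℓ′ r ρ τ : Level

-- Reducts play the role of the smaller elements, hence the flip: the sequence
-- f satisfies f 0 ≡ t and f n ⟶ f (suc n) for all n. This is deliberately the
-- negative notion, not accessibility; the two agree only classically.
StronglyNormalizing : {A : Set a} → Rel A ℓ → Pred A (a ⊔ ℓ)
StronglyNormalizing _⟶_ t =
  ¬ (∃[ f ] InfiniteDescendingSequenceFrom (flip _⟶_) f t)

Terminating : {A : Set a} → Rel A ℓ → Set (a ⊔ ℓ)
Terminating _⟶_ = ∀ t → StronglyNormalizing _⟶_ t

-- `step ϱ` is the one-step reduction given by the single rule ϱ. Sets of rules
-- are kept apart from the relations they generate because disjoint sets of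
-- rules may generate overlapping relations.
ReductionBy : {A : Set a} {Rule : Set r} →
              (Rule → Rel A ℓ) → Pred Rule ρ → Rel A (r ⊔ ℓ ⊔ ρ)
ReductionBy step R t t′ = ∃[ ϱ ] (ϱ ∈ R × step ϱ t t′)

-- The inclusion of the pure terms among all terms is the map ι.
PSN : {A : Set a} {B : Set b} →
      (A → B) → Rel A ℓ → Rel B ℓ′ → Set (a ⊔ b ⊔ ℓ ⊔ ℓ′)
PSN ι _⟶ₚ_ _⟶_ =
  ∀ t → StronglyNormalizing _⟶ₚ_ t → StronglyNormalizing _⟶_ (ι t)

-- A typing system enters only through its set of typable terms.
SN : {A : Set a} → Pred A τ → Rel A ℓ → Set (a ⊔ τ ⊔ ℓ)
SN Typable _⟶_ = ∀ t → t ∈ Typable → StronglyNormalizing _⟶_ t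

{-# OPTIONS --safe #-}

-- Along an infinite reduction sequence f of a typable term t, every step is
-- simulated from ι (Ateb t). As R₁ terminates, every tail of f contains an
-- R₂-step, whose simulation is non-empty, so ι (Ateb t) has an infinite
-- reduction sequence too. But Ateb t is typable, hence strongly normalizing, and
-- PSN makes ι (Ateb t) strongly normalizing.
module Submission where

open import Defs
open import Axiom.DoubleNegationElimination using (em⇒dne)
open import Axiom.ExcludedMiddle using (ExcludedMiddle)
import Data.Empty as Empty
open import Data.Nat.Base using (ℕ; zero; suc; _+_)
open import Data.Nat.GeneralisedArithmetic using (fold)
open import Data.Product.Base using (Σ; ∃-syntax; _×_; _,_; proj₁; proj₂)
open import Data.Sum.Base using (_⊎_; inj₁; inj₂)
open import Data.Unit.Base using (⊤; tt)
open import Function.Base using (_∘_; flip)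
open import Function.Definitions using (Injective)
open import Induction.InfiniteDescent
  using (Descent; InfiniteDescendingSequence; InfiniteDescendingSequenceFrom)
open import Level using (Level; 0ℓ)
open import Relation.Binary.Core using (Rel; _⇒_)
open import Relation.Binary.Construct.Closure.ReflexiveTransitive
  using (Star; ε; _◅_; _◅◅_)
open import Relation.Binary.Construct.Closure.Transitive
  using (TransClosure; [_]; _∷_)
open import Relation.Binary.Construct.Union using (_∪_)
open import Relation.Binary.PropositionalEquality.Core using (_≡_; refl)
open import Relation.Nullary.Negation.Core using (¬_; contradiction)
open import Relation.Unary using (Pred; _∈_; _⊥_; Universal) renaming (_∪_ to _∪ᵖ_)

private
  variable
    a b p q r ℓ ℓ₁ ℓ₂ : Level
    A B : Set a

⁺⇒* : {_⟶_ : Rel A ℓ} → TransClosure _⟶_ ⇒ Star _⟶_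
⁺⇒* [ s ]    = s ◅ ε
⁺⇒* (s ∷ ss) = s ◅ ⁺⇒* ss

-- The infinite sequence is emitted one step at a time; the rest is kept as a possibly empty
-- reduction.
*-⁺-uncons : {_⟶_ : Rel A ℓ} {x y z : A} → Star _⟶_ x y → TransClosure _⟶_ y z →
             ∃[ w ] (x ⟶ w × Star _⟶_ w z)
*-⁺-uncons ε        [ s ]    = _ , s , ε
*-⁺-uncons ε        (s ∷ ss) = _ , s , ⁺⇒* ss
*-⁺-uncons (s ◅ ss) ts       = _ , s , ss ◅◅ ⁺⇒* ts

-- `descent` is a function giving explicit witnesses, so iterating it on points paired with their
-- proofs of `P` requires no choice principle.
descent⇒sequence : {_<_ : Rel A ℓ} {P : Pred A p} → Descent _<_ P →
                   ∀ {x} → P x → ∃[ f ] InfiniteDescendingSequenceFrom _<_ f x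
descent⇒sequence {A = A} {_<_ = _<_} {P = P} descent {x} px =
  proj₁ ∘ state , refl , λ n → proj₁ (proj₂ (descent (proj₂ (state n))))
  where
  next : Σ A P → Σ A P
  next (_ , py) = let z , _ , pz = descent py in z , pz

  state : ℕ → Σ A P
  state = fold (x , px) next

-- Valued in the lowest universe whatever the levels of `P` and `Q`, so that excluded middle at `0ℓ`
-- suffices below.
IsInj₂ : {P : Set p} {Q : Set q} → P ⊎ Q → Set
IsInj₂ (inj₁ _) = Empty.⊥
IsInj₂ (inj₂ _) = ⊤

-- Otherwise the sequence from `f n` on would be an infinite `⟶₁`-reduction. This is the only
-- classical step.
every-tail-has-inj₂ :
  ExcludedMiddle 0ℓ → (_⟶₁_ : Rel A ℓ₁) (_⟶₂_ : Rel A ℓ₂) → Terminating _⟶₁_ →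
  ∀ f (steps : InfiniteDescendingSequence (flip (_⟶₁_ ∪ _⟶₂_)) f) →
  ∀ n → ∃[ k ] IsInj₂ (steps (k + n))
every-tail-has-inj₂ em _⟶₁_ _ terminating f steps n = em⇒dne em λ none →
  terminating (f n) ((λ k → f (k + n)) , refl , tail₁ none)
  where
  tail₁ : ¬ (∃[ k ] IsInj₂ (steps (k + n))) → ∀ k → f (k + n) ⟶₁ f (suc k + n)
  -- The refutation is abstracted together with `steps (k + n)`, so that its type is refined by the
  -- case split.
  tail₁ none k with steps (k + n) | (λ is₂ → none (k , is₂))
  ... | inj₁ s | _     = s
  ... | inj₂ _ | ¬inj₂ = contradiction tt ¬inj₂

simulation⇒SN :
  ExcludedMiddle 0ℓ →
  {_⟶₁_ : Rel A ℓ₁} {_⟶₂_ : Rel A ℓ₂} {_⟶_ : Rel B ℓ} {_𝓡_ : B → A → Set r} →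
  Terminating _⟶₁_ →
  (∀ t t′ → t ⟶₁ t′ → ∀ u → u 𝓡 t → ∃[ u′ ] (Star _⟶_ u u′ × u′ 𝓡 t′)) →
  (∀ t t′ → t ⟶₂ t′ → ∀ u → u 𝓡 t → ∃[ u′ ] (TransClosure _⟶_ u u′ × u′ 𝓡 t′)) →
  ∀ {x u t} → Star _⟶_ x u → u 𝓡 t →
  StronglyNormalizing _⟶_ x → StronglyNormalizing (_⟶₁_ ∪ _⟶₂_) t
simulation⇒SN {B = B} em {_⟶₁_} {_⟶₂_} {_⟶_} {_𝓡_} terminating sim* sim⁺ x⟶*u u𝓡t sn
  (f , refl , steps) = sn (descent⇒sequence productive (0 , _ , x⟶*u , u𝓡t))
  where
  -- The emitted term `y` may lag behind the term `v` related to `f n`; the reduction between them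
  -- is still to be emitted.
  Follows : B → ℕ → Set _
  Follows y n = ∃[ v ] (Star _⟶_ y v × v 𝓡 f n)

  -- `y` stays fixed: the simulating reduction, possibly empty, is appended to the pending one.
  advance : ∀ {y} n → Follows y n → Follows y (suc n)
  advance n (v , y⟶*v , v𝓡) with steps n
  ... | inj₁ s = let v′ , v⟶*v′ , v′𝓡 = sim* _ _ s v v𝓡 in v′ , y⟶*v ◅◅ v⟶*v′ , v′𝓡
  ... | inj₂ s = let v′ , v⟶⁺v′ , v′𝓡 = sim⁺ _ _ s v v𝓡 in v′ , y⟶*v ◅◅ ⁺⇒* v⟶⁺v′ , v′𝓡

  advance* : ∀ {y} k n → Follows y n → Follows y (k + n)
  advance* zero    n follows = follows
  advance* (suc k) n follows = advance (k + n) (advance* k n follows)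

  -- A `⟶₂`-step makes the pending reduction non-empty, so its first step can be emitted.
  advance⁺ : ∀ {y} n → IsInj₂ (steps n) → Follows y n →
             ∃[ z ] (y ⟶ z × Follows z (suc n))
  advance⁺ n is₂ (v , y⟶*v , v𝓡) with inj₂ s ← steps n =
    let v′ , v⟶⁺v′ , v′𝓡 = sim⁺ _ _ s v v𝓡
        z , y⟶z , z⟶*v′ = *-⁺-uncons y⟶*v v⟶⁺v′
    in z , y⟶z , v′ , z⟶*v′ , v′𝓡

  productive : Descent (flip _⟶_) (λ y → ∃[ n ] Follows y n)
  productive (n , follows) =
    -- Steps before index `k + n` only lengthen the pending reduction; the `⟶₂`-step there
    -- guarantees progress.
    let k , is₂ = every-tail-has-inj₂ em _⟶₁_ _⟶₂_ terminating f steps n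
        z , y⟶z , follows′ = advance⁺ (k + n) is₂ (advance* k n follows)
    in z , y⟶z , suc (k + n) , follows′

theorem2p7 :
    ExcludedMiddle 0ℓ →
    ∀ {a b p r s ρ₁ ρ₂ τ τ′ ℓ}
    (Λ : Set a) (_⟶ₚ_ : Rel Λ p)
    (ΛX : Set b) (ι : Λ → ΛX) → Injective _≡_ _≡_ ι →
    (Rule : Set r) (step : Rule → Rel ΛX s)
    (R₁ : Pred Rule ρ₁) (R₂ : Pred Rule ρ₂) →
    Universal (R₁ ∪ᵖ R₂) → R₁ ⊥ R₂ →
    let _⟶₁_ = ReductionBy step R₁
        _⟶₂_ = ReductionBy step R₂
        _⟶_ = _⟶₁_ ∪ _⟶₂_
        _⟶*_ = Star _⟶_
        _⟶⁺_ = TransClosure _⟶_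
    in
    Terminating _⟶₁_ →
    (T : Pred Λ τ) (T′ : Pred ΛX τ′) →
    SN T _⟶ₚ_ →
    (Ateb : ΛX → Λ) (_𝓡_ : Rel ΛX ℓ) →
    (∀ t → t ∈ T′ → Ateb t ∈ T) →
    (∀ t → t ∈ T′ → ∃[ u ] (u 𝓡 t × ι (Ateb t) ⟶* u)) →
    (∀ t t′ → t ⟶₁ t′ → ∀ u → u 𝓡 t → ∃[ u′ ] (u ⟶* u′ × u′ 𝓡 t′)) →
    (∀ t t′ → t ⟶₂ t′ → ∀ u → u 𝓡 t → ∃[ u′ ] (u ⟶⁺ u′ × u′ 𝓡 t′)) →
    PSN ι _⟶ₚ_ _⟶_ → SN T′ _⟶_
theorem2p7 em _ _ _ _ _ _ _ _ _ _ _ terminating₁ _ _ snₚ Ateb _𝓡_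
  preservation initialisation sim* sim⁺ psn t t∈T′ =
  let u , u𝓡t , Ateb-t⟶*u = initialisation t t∈T′
  in simulation⇒SN em {_𝓡_ = _𝓡_} terminating₁ sim* sim⁺ Ateb-t⟶*u u𝓡t
       (psn (Ateb t) (snₚ (Ateb t) (preservation t t∈T′)))
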